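{- Let $1\le m\le n$ be integers. There is a bijection between $\mathscr C(m,n)$ and $\mathscr F(n+1,n+1-m)$.
   Context: For $\vec r=(r_1,\dots,r_n)$ a vector of nonnegative integers and $\sigma\in\mathfrak S_m$, the pair $(\vec r,\sigma)$ is called compatible if for every $k\in\{1,\dots,n\}$ the values $1+\sum_{i=1}^{k-1}r_i,\dots,\sum_{i=1}^k r_i$ appear from left to right in the word $\sigma=\sigma_1\sigma_2\cdots\sigma_m$; $\vec r$ is called balanced if there exist integers $0=:k_0<k_1<\dots<k_{n-m}<k_{n-m+1}:=n+1$ such that $\sum_{s=1}^{k_i}r_s=k_i-i$ for all $1\le i\le n-m$, $\sum_{s=1}^j r_s>j-i-1$ for all $k_i<j<k_{i+1}$ and $0\le i\le n-m$, and $\sum_{s=1}^n r_s=m$. $\mathscr C(m,n)$ is the set of compatible pairs $(\vec r,\sigma)$ with $\vec r$ balanced. $\mathscr F(n+1,n+1-m)$ denotes the set of spanning forests on $n+1$ labeled vertices consisting of exactly $n+1-m$ trees, where a fixed specified set of $n+1-m$ vertices are the roots of the different trees (each tree contains exactly one of them). -}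

module Defs where

open import Data.Nat using (ℕ; zero; suc; _+_; _∸_; _≤_; _<_)
open import Data.Integer as ℤ using (ℤ; +_)
open import Data.Fin as Fin using (Fin; toℕ)
open import Data.Fin.Subset using (Subset; _∈_)
open import Data.Bool using (Bool; true; false)
open import Data.Vec using (Vec; lookup; toList)
open import Data.List using (List; []; _∷_; _++_; [_]; length; take)
open import Data.Nat.ListAction using (sum)
open import Data.List.Relation.Unary.Linked using (Linked)
open import Data.List.Relation.Unary.Unique.Propositional using (Unique)
open import Data.Product using (Σ; ∃; _×_)
open import Relation.Binary.PropositionalEquality using (_≡_)
open import Relation.Nullary using (¬_)

S : ∀ {n} → Vec ℕ n → ℕ → ℕ
S r j = sum (take j (toList r))

-- σ ∈ 𝔖_m is represented by its one-line word σ₁σ₂⋯σ_m, i.e. a vector of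
-- length m of values in Fin m (value v ∈ {1,…,m} is stored as v-1), injective.
IsPerm : ∀ {m} → Vec (Fin m) m → Set
IsPerm {m} σ = ∀ (i j : Fin m) → lookup σ i ≡ lookup σ j → i ≡ j

-- Block k (k = 1,…,n) consists of the values 1+S(k-1),…,S(k); shifted to
-- 0-based values it is S(k-1) ≤ v < S(k).  Compatibility: every value of the
-- block appears in σ (is a value < m), and they appear from left to right.
Compatible : ∀ {m n} → Vec ℕ n → Vec (Fin m) m → Set
Compatible {m} {n} r σ =
  ∀ (k : Fin n) →
    (∀ (v : ℕ) → S r (toℕ k) ≤ v → v < S r (suc (toℕ k)) → v < m)
    × (∀ (i j : Fin m) → i Fin.< j →
         S r (toℕ k) ≤ toℕ (lookup σ i) → toℕ (lookup σ i) < S r (suc (toℕ k)) →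
         S r (toℕ k) ≤ toℕ (lookup σ j) → toℕ (lookup σ j) < S r (suc (toℕ k)) →
         toℕ (lookup σ i) < toℕ (lookup σ j))

Balanced : ∀ {n} → ℕ → Vec ℕ n → Set
Balanced {n} m r =
  Σ (ℕ → ℕ) λ ks →
    ks 0 ≡ 0
    × ks (suc (n ∸ m)) ≡ suc n
    × (∀ i → i ≤ n ∸ m → ks i < ks (suc i))
    × (∀ i → 1 ≤ i → i ≤ n ∸ m → + S r (ks i) ≡ + ks i ℤ.- + i)
    × (∀ i j → i ≤ n ∸ m → ks i < j → j < ks (suc i) →
         + S r j ℤ.> + j ℤ.- + i ℤ.- + 1)
    × S r n ≡ m

-- Elements of 𝒞(m,n): compatible pairs (r, σ) with r balanced.
-- The proof fields are irrelevant, so an element is determined by (r, σ).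
record 𝒞 (m n : ℕ) : Set where
  constructor mk𝒞
  field
    r        : Vec ℕ n
    σ        : Vec (Fin m) m
    .perm     : IsPerm σ
    .compat   : Compatible r σ
    .balanced : Balanced m r

Adj : ∀ {N} → Vec (Vec Bool N) N → Fin N → Fin N → Set
Adj A u v = lookup (lookup A u) v ≡ true

IsSimpleGraph : ∀ {N} → Vec (Vec Bool N) N → Set
IsSimpleGraph {N} A =
  (∀ (u v : Fin N) → lookup (lookup A u) v ≡ lookup (lookup A v) u)
  × (∀ (v : Fin N) → lookup (lookup A v) v ≡ false)

data Walk {N} (A : Vec (Vec Bool N) N) : Fin N → Fin N → Set where
  here : ∀ {u} → Walk A u u
  step : ∀ {u w v} → Adj A u w → Walk A w v → Walk A u v

HasCycle : ∀ {N} → Vec (Vec Bool N) N → Set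
HasCycle {N} A =
  Σ (Fin N) λ v → Σ (List (Fin N)) λ vs →
    2 ≤ length vs × Unique (v ∷ vs) × Linked (Adj A) (v ∷ vs ++ [ v ])

IsRootedForest : ∀ {N} → Subset N → Vec (Vec Bool N) N → Set
IsRootedForest {N} R A =
  IsSimpleGraph A
  × ¬ HasCycle A
  × (∀ (v : Fin N) → Σ (Fin N) λ ρ → ρ ∈ R × Walk A v ρ)
  × (∀ (ρ ρ' : Fin N) → ρ ∈ R → ρ' ∈ R → Walk A ρ ρ' → ρ ≡ ρ')

-- ℱ(N, |R|) with root set R; elements determined by their edge set.
record ℱ (N : ℕ) (R : Subset N) : Set where
  constructor mkℱ
  field
    adj     : Vec (Vec Bool N) N
    .forest : IsRootedForest R adj

{-# OPTIONS --safe #-}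

-- Breadth-first search turns a rooted forest into a code. List the vertices with the roots
-- first and then, for each listed vertex in turn, its children in increasing order of label:
-- r_j is the number of children of the j-th vertex of the list and σ gives the places of the
-- non-roots in it, so that block j of σ consists of the children of the j-th vertex.
-- Compatibility says that siblings are listed in increasing order, and balancedness says
-- exactly that every vertex is listed before its children.

module Submission where

open import Defs
open import Data.Bool using (Bool; true; false)
import Data.Bool.Properties as Bool
open import Data.Fin as Fin using (Fin; toℕ; fromℕ<)
import Data.Fin.Properties as Fin
open import Data.Fin.Subset using (Subset; ∣_∣; ⊤; ∁; _∈_; _∉_; _⊆_)
open import Data.Fin.Subset.Properties
  using (_∈?_; ∈⊤; ∣⊤∣≡n; ∣p∣≤n; p⊆q⇒∣p∣≤∣q∣; p⊂q⇒∣p∣<∣q∣; ∣∁p∣≡n∸∣p∣)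
open import Data.Integer as ℤ using (+<+) renaming (+_ to int)
import Data.Integer.Properties as ℤ
open import Data.List using (List; []; _∷_; _++_; [_])
import Data.List.Membership.Propositional as List
open import Data.List.Relation.Unary.All as All using (All; []; _∷_)
import Data.List.Relation.Unary.All.Properties as All
open import Data.List.Relation.Unary.AllPairs using ([]; _∷_)
import Data.List.Relation.Unary.AllPairs.Properties as AllPairs
open import Data.List.Relation.Unary.Any using (here; there)
open import Data.List.Relation.Unary.Linked using (Linked; [-]; _∷_)
open import Data.List.Relation.Unary.Unique.Propositional using (Unique)
open import Data.Nat using (ℕ; zero; suc; _+_; _∸_; _≤_; _<_; z≤n; s≤s; s≤s⁻¹; _⊔_)
open import Data.Nat.Induction using (<-wellFounded)
open import Data.Nat.Properties
open import Data.Product using (∃; ∃₂; _×_; _,_; proj₁; proj₂)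
open import Data.Sum as Sum using (_⊎_; inj₁; inj₂)
open import Data.Vec using (Vec; []; _∷_; lookup; tabulate; map; here; there)
open import Data.Vec.Properties
  using (≡-dec; lookup∘tabulate; tabulate∘lookup; tabulate-cong; []=⇒lookup; lookup⇒[]=)
open import Function using (_∘_; mk⇔; Injective; Surjective)
open import Function.Bundles using (_⤖_; mk⤖)
open import Induction.WellFounded using (Acc; acc)
open import Relation.Binary using (Decidable; tri<; tri≈; tri>)
open import Relation.Binary.PropositionalEquality
  using (_≡_; _≢_; refl; sym; trans; cong; cong₂; subst; subst₂; module ≡-Reasoning)
open import Relation.Nullary
  using (¬_; Dec; yes; no; does; contradiction; _×-dec_; _⊎-dec_; _→-dec_; recompute)
open import Relation.Nullary.Decidable using (dec-true; map′)

-- Rooted forests and parent relations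

-- A graph in `ℱ` forgets which end of an edge is the parent, so both directions pass through a
-- parent relation with a height that strictly falls towards the parent: the place in the list for a
-- code, the distance to the root set for a forest. All recursion along the trees runs on this
-- height. Injectivity does not come from a two-sided inverse. Two codes with the same edges are
-- compared directly: induction on places shows that their parents agree, and the order of the list
-- depends only on parents and labels, so `σ` and then `r` agree. The numbers `k_i` of balancedness
-- are the first times at which `j - S r j` reaches `i`. They carry no information beyond the
-- inequality `j ≤ S r j + (n ∸ m)` for `j ≤ n` and the total `m`, and these two conditions are
-- decidable.

Edge : ∀ {V : Set} → (V → V → Set) → V → V → Set
Edge Par u v = Par u v ⊎ Par v u

Describes : ∀ {N} → (Fin N → Fin N → Set) → Vec (Vec Bool N) N → Set
Describes Par A = ∀ u v → (Adj A u v → Edge Par u v) × (Edge Par u v → Adj A u v)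

edge? : ∀ {V : Set} {Par : V → V → Set} → Decidable Par → Decidable (Edge Par)
edge? Par? u v = Par? u v ⊎-dec Par? v u

graphOf : ∀ {N} {Par : Fin N → Fin N → Set} → Decidable Par → Vec (Vec Bool N) N
graphOf Par? = tabulate λ u → tabulate λ v → does (edge? Par? u v)

lookup-graphOf : ∀ {N} {Par : Fin N → Fin N → Set} (Par? : Decidable Par) u v →
  lookup (lookup (graphOf Par?) u) v ≡ does (edge? Par? u v)
lookup-graphOf Par? u v =
  trans (cong (λ row → lookup row v) (lookup∘tabulate _ u)) (lookup∘tabulate _ v)

does⇒ : ∀ {A : Set} (a? : Dec A) → does a? ≡ true → A
does⇒ (yes a) _ = a

graphOf-describes : ∀ {N} {Par : Fin N → Fin N → Set} (Par? : Decidable Par) →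
  Describes Par (graphOf Par?)
graphOf-describes Par? u v =
  (λ a → does⇒ (edge? Par? u v) (trans (sym (lookup-graphOf Par? u v)) a)) ,
  (λ e → trans (lookup-graphOf Par? u v) (dec-true (edge? Par? u v) e))

lookup-injective : ∀ {X : Set} {n} {xs ys : Vec X n} →
  (∀ i → lookup xs i ≡ lookup ys i) → xs ≡ ys
lookup-injective {xs = xs} {ys} eq =
  trans (sym (tabulate∘lookup xs)) (trans (tabulate-cong eq) (tabulate∘lookup ys))

describes-unique : ∀ {N} {Par : Fin N → Fin N → Set} {A B} →
  Describes Par A → Describes Par B → A ≡ B
describes-unique dA dB = lookup-injective λ u → lookup-injective λ v → Bool.⇔→≡
  (mk⇔ (proj₂ (dB u v) ∘ proj₁ (dA u v)) (proj₂ (dA u v) ∘ proj₁ (dB u v)))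

record ParentStructure {N} (R : Subset N) (h : Fin N → ℕ)
                       (Par : Fin N → Fin N → Set) : Set where
  field
    orphan   : ∀ {ρ u} → ρ ∈ R → ¬ Par ρ u
    parent   : ∀ {v} → v ∉ R → ∃ (Par v)
    unique   : ∀ {v u w} → Par v u → Par v w → u ≡ w
    descends : ∀ {v u} → Par v u → h u < h v

module FromParents {N : ℕ} {R : Subset N} {h : Fin N → ℕ} {Par : Fin N → Fin N → Set}
                   (ps : ParentStructure R h Par)
                   {A : Vec (Vec Bool N) N} (A-desc : Describes Par A) where
  open ParentStructure ps

  split : ∀ {u v} → Adj A u v → Edge Par u v
  split = proj₁ (A-desc _ _)

  join : ∀ {u v} → Edge Par u v → Adj A u v
  join = proj₂ (A-desc _ _)

  simple : IsSimpleGraph A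
  simple = (λ u v → Bool.⇔→≡ (mk⇔ flip-adj flip-adj)) , irreflexive
    where
    flip-adj : ∀ {u v} → Adj A u v → Adj A v u
    flip-adj = join ∘ Sum.swap ∘ split

    no-loop : ∀ {v} → ¬ Adj A v v
    no-loop a with split a
    ... | inj₁ p = <-irrefl refl (descends p)
    ... | inj₂ p = <-irrefl refl (descends p)

    irreflexive : ∀ v → lookup (lookup A v) v ≡ false
    irreflexive v with lookup (lookup A v) v in eq
    ... | true  = contradiction eq no-loop
    ... | false = refl

  -- Parents being unique, a path that has gone down an edge and never
  -- backtracks keeps going down.
  descending : ∀ {x y t} zs → Par y x → Linked (Adj A) (y ∷ zs ++ [ t ]) →
    Unique (x ∷ y ∷ zs) → All (t ≢_) (x ∷ y ∷ zs) →
    h x < h t × ∃ λ z → z List.∈ y ∷ zs × Par t z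
  descending [] yx (yt ∷ _) _ (t≢x ∷ _) with split yt
  ... | inj₁ p = contradiction (unique p yx) t≢x
  ... | inj₂ p = <-trans (descends yx) (descends p) , _ , here refl , p
  descending (z ∷ zs) yx (yz ∷ l) ((_ ∷ x≢z ∷ _) ∷ u) (_ ∷ t≢) with split yz
  ... | inj₁ p = contradiction (unique yx p) x≢z
  ... | inj₂ p with descending zs p l u t≢
  ...   | y<t , w , w∈ , q = <-trans (descends yx) y<t , w , there w∈ , q

  -- Since parents are unique, a walk without backtracking first climbs and then descends. Either it
  -- climbs all the way to `t`, or its last step enters `t` from the parent of `t`.
  arriving : ∀ {x t} zs → Linked (Adj A) (x ∷ zs ++ [ t ]) →
    Unique (x ∷ zs) → All (t ≢_) (x ∷ zs) →
    (∃ λ z → z List.∈ x ∷ zs × Par t z) ⊎ h t < h x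
  arriving [] (xt ∷ _) _ _ with split xt
  ... | inj₁ p = inj₂ (descends p)
  ... | inj₂ p = inj₁ (_ , here refl , p)
  arriving (y ∷ zs) (xy ∷ l) u@(_ ∷ u′) t≢@(_ ∷ t≢′) with split xy
  ... | inj₁ p = Sum.map (λ { (z , z∈ , q) → z , there z∈ , q })
                         (λ t<y → <-trans t<y (descends p)) (arriving zs l u′ t≢′)
  ... | inj₂ p with descending zs p l u t≢
  ...   | _ , z , z∈ , q = inj₁ (z , there z∈ , q)

  -- Going round the cycle from `v`, either the height rises all the way or falls all the way, which
  -- is absurd on returning to `v`, or one of `v` and `a` has two distinct parents on the cycle.
  acyclic : ¬ HasCycle A
  acyclic (v , a ∷ [] , s≤s () , _)
  acyclic (v , a ∷ b ∷ ws , _ , (v≢@(v≢a ∷ v≢′) ∷ u@(a∉ ∷ u′)) , va ∷ ab ∷ l)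
    with split va | split ab
  ... | inj₂ p | inj₁ q = All.head v≢′ (unique p q)
  ... | inj₂ p | inj₂ q = <-asym (descends p) (proj₁ (descending ws q l u v≢))
  ... | inj₁ p | inj₂ q with descending ws q l u v≢
  ...   | _ , z , z∈ , r = All.lookup a∉ z∈ (unique p r)
  acyclic (v , a ∷ b ∷ ws , _ , (v≢@(v≢a ∷ v≢′) ∷ u@(a∉ ∷ u′)) , va ∷ ab ∷ l)
      | inj₁ p | inj₁ q with arriving ws l u′ v≢′
  ... | inj₁ (z , z∈ , r) = All.lookup a∉ z∈ (unique p r)
  ... | inj₂ v<b = <-asym v<b (<-trans (descends q) (descends p))

  -- An invariant of walks: `ρ` is the root of the tree of the vertex. It crosses edges in both
  -- directions and determines `ρ`, so no walk joins two distinct roots.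
  data Under : Fin N → Fin N → Set where
    root  : ∀ {ρ} → ρ ∈ R → Under ρ ρ
    child : ∀ {v u ρ} → Par v u → Under u ρ → Under v ρ

  under-unique : ∀ {v ρ ρ′} → Under v ρ → Under v ρ′ → ρ ≡ ρ′
  under-unique (root _)    (root _)    = refl
  under-unique (root r)    (child p _) = contradiction p (orphan r)
  under-unique (child p _) (root r)    = contradiction p (orphan r)
  under-unique (child p a) (child q b) with unique p q
  ... | refl = under-unique a b

  under-adj : ∀ {u v ρ} → Adj A u v → Under u ρ → Under v ρ
  under-adj a b with split a
  under-adj a b           | inj₂ q = child q b
  under-adj a (root r)    | inj₁ q = contradiction q (orphan r)
  under-adj a (child p b) | inj₁ q with unique p q
  ... | refl = b

  under-walk : ∀ {u v ρ} → Walk A u v → Under u ρ → Under v ρ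
  under-walk here       b = b
  under-walk (step a w) b = under-walk w (under-adj a b)

  reaches-root : ∀ v → Acc _<_ (h v) → ∃ λ ρ → ρ ∈ R × Walk A v ρ
  reaches-root v (acc rs) with v ∈? R
  ... | yes r = v , r , here
  ... | no ¬r with parent ¬r
  ...   | u , p with reaches-root u (rs (descends p))
  ...     | ρ , ρ∈R , w = ρ , ρ∈R , step (join (inj₁ p)) w

  isRootedForest : IsRootedForest R A
  isRootedForest = simple , acyclic , (λ v → reaches-root v (<-wellFounded (h v))) ,
    λ ρ ρ′ r r′ w → under-unique (under-walk w (root r)) (root r′)

-- Conversely, every edge of a rooted forest joins a vertex to its parent: any other
-- edge would close a cycle with a path in the tree.

Least : (ℕ → Set) → Set
Least P = ∃ λ t → P t × (∀ {s} → P s → t ≤ s)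

least : ∀ {P : ℕ → Set} → (∀ t → Dec (P t)) → ∀ {b} → P b → Least P
least {P} P? {b} pb = go b 0 (λ _ → z≤n) (subst P (sym (+-identityʳ b)) pb)
  where
  go : ∀ f t → (∀ {s} → P s → t ≤ s) → P (f + t) → Least P
  go f t below pft with P? t
  go f t below pft | yes pt = t , pt , below
  go zero t below pft | no ¬pt = contradiction pft ¬pt
  go (suc f) t below pft | no ¬pt =
    go f (suc t) (λ ps → ≤∧≢⇒< (below ps) λ { refl → ¬pt ps })
       (subst P (sym (+-suc f t)) pft)

module ToParents {N : ℕ} {R : Subset N} {A : Vec (Vec Bool N) N} (forest : IsRootedForest R A) where

  private
    symmetric : ∀ {u v} → Adj A u v → Adj A v u
    symmetric {u} {v} a = trans (sym (proj₁ (proj₁ forest) u v)) a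

    no-loop : ∀ {v} → ¬ Adj A v v
    no-loop {v} a with trans (sym a) (proj₂ (proj₁ forest) v)
    ... | ()

    no-cycle : ¬ HasCycle A
    no-cycle = proj₁ (proj₂ forest)

    one-root : ∀ ρ ρ′ → ρ ∈ R → ρ′ ∈ R → Walk A ρ ρ′ → ρ ≡ ρ′
    one-root = proj₂ (proj₂ (proj₂ forest))

  -- A walk of exactly `t` edges leads from the vertex to a root. Fixing the length makes this
  -- decidable, so that a shortest walk can be found.
  RootWithin : ℕ → Fin N → Set
  RootWithin zero    v = v ∈ R
  RootWithin (suc t) v = ∃ λ w → Adj A v w × RootWithin t w

  rootWithin? : ∀ t v → Dec (RootWithin t v)
  rootWithin? zero    v = v ∈? R
  rootWithin? (suc t) v =
    Fin.any? λ w → (lookup (lookup A v) w Bool.≟ true) ×-dec rootWithin? t w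

  walk⇒within : ∀ {v ρ} → ρ ∈ R → Walk A v ρ → ∃ λ t → RootWithin t v
  walk⇒within r here = 0 , r
  walk⇒within r (step a w) with walk⇒within r w
  ... | t , d = suc t , _ , a , d

  abstract
    shortest : ∀ v → Least (λ t → RootWithin t v)
    shortest v with proj₁ (proj₂ (proj₂ forest)) v
    ... | ρ , r , w = least (λ t → rootWithin? t v) (proj₂ (walk⇒within r w))

  depth : Fin N → ℕ
  depth v = proj₁ (shortest v)

  depth-root : ∀ {ρ} → ρ ∈ R → depth ρ ≡ 0
  depth-root {ρ} r = n≤0⇒n≡0 (proj₂ (proj₂ (shortest ρ)) {0} r)

  towards-root : ∀ v → v ∉ R → ∃ λ u → Adj A v u × depth u < depth v
  towards-root v v∉ with shortest v
  ... | zero  , r , _ = contradiction r v∉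
  ... | suc t , (w , a , d) , _ = w , a , s≤s (proj₂ (proj₂ (shortest w)) d)

  up : Fin N → Fin N
  up v with v ∈? R
  ... | yes _ = v
  ... | no v∉ = proj₁ (towards-root v v∉)

  up-spec : ∀ {v} → v ∉ R → Adj A v (up v) × depth (up v) < depth v
  up-spec {v} v∉ with v ∈? R
  ... | yes r  = contradiction r v∉
  ... | no v∉′ = proj₂ (towards-root v v∉′)

  Par : Fin N → Fin N → Set
  Par v u = v ∉ R × up v ≡ u

  private
    edge⇒adj : ∀ {u v} → Edge Par u v → Adj A u v
    edge⇒adj (inj₁ (u∉ , refl)) = proj₁ (up-spec u∉)
    edge⇒adj (inj₂ (v∉ , refl)) = symmetric (proj₁ (up-spec v∉))

    data Path : Fin N → List (Fin N) → Fin N → Set where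
      stop : ∀ {u} → Path u [ u ] u
      _∷_  : ∀ {u w v xs} → Edge Par u w → Path w xs v → Path u (u ∷ xs) v

    snoc : ∀ {u v w xs} → Path u xs v → Edge Par v w → Path u (xs ++ [ w ]) w
    snoc stop    e = e ∷ stop
    snoc (f ∷ p) e = f ∷ snoc p e

    closed : ∀ {u v w xs} → Path u xs v → Adj A v w → Linked (Adj A) (xs ++ [ w ])
    closed stop                a = a ∷ [-]
    closed (e ∷ stop)          a = edge⇒adj e ∷ a ∷ [-]
    closed (e ∷ p@(_ ∷ _)) a = edge⇒adj e ∷ closed p a

    -- Paths in the tree are built by extending at the deeper end; the bound on the
    -- depths keeps the new end vertex off the path.
    Bounded : Fin N → Fin N → Fin N → Set
    Bounded u v x = x ≡ u ⊎ x ≡ v ⊎ depth x < depth u ⊔ depth v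

    SimplePath : Fin N → Fin N → Set
    SimplePath u v = ∃ λ xs → Path u xs v × Unique xs × All (Bounded u v) xs

    extendˡ : ∀ {u v} → u ∉ R → u ≢ v → depth v ≤ depth u →
      SimplePath (up u) v → SimplePath u v
    extendˡ {u} {v} u∉ u≢v v≤u (xs , p , unq , bnd) =
      u ∷ xs , inj₁ (u∉ , refl) ∷ p , All.map fresh bnd ∷ unq , inj₁ refl ∷ All.map weaken bnd
      where
      up<u = proj₂ (up-spec u∉)
      below : ∀ {x} → depth x < depth (up u) ⊔ depth v → depth x < depth u
      below lt = <-≤-trans lt (⊔-lub (<⇒≤ up<u) v≤u)
      fresh : ∀ {x} → Bounded (up u) v x → u ≢ x
      fresh (inj₁ refl)        eq = <-irrefl (cong depth (sym eq)) up<u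
      fresh (inj₂ (inj₁ refl)) eq = u≢v eq
      fresh (inj₂ (inj₂ lt))   eq = <-irrefl (cong depth (sym eq)) (below lt)
      weaken : ∀ {x} → Bounded (up u) v x → Bounded u v x
      weaken (inj₁ refl)        = inj₂ (inj₂ (m≤n⇒m≤n⊔o _ up<u))
      weaken (inj₂ (inj₁ refl)) = inj₂ (inj₁ refl)
      weaken (inj₂ (inj₂ lt))   = inj₂ (inj₂ (m≤n⇒m≤n⊔o _ (below lt)))

    extendʳ : ∀ {u v} → v ∉ R → u ≢ v → depth u ≤ depth v →
      SimplePath u (up v) → SimplePath u v
    extendʳ {u} {v} v∉ u≢v u≤v (xs , p , unq , bnd) =
      xs ++ [ v ] , snoc p (inj₂ (v∉ , refl)) ,
      AllPairs.++⁺ unq ([] ∷ []) (All.map (λ b → fresh b ∷ []) bnd) ,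
      All.++⁺ (All.map weaken bnd) (inj₂ (inj₁ refl) ∷ [])
      where
      up<v = proj₂ (up-spec v∉)
      below : ∀ {x} → depth x < depth u ⊔ depth (up v) → depth x < depth v
      below lt = <-≤-trans lt (⊔-lub u≤v (<⇒≤ up<v))
      fresh : ∀ {x} → Bounded u (up v) x → x ≢ v
      fresh (inj₁ refl)        eq = u≢v eq
      fresh (inj₂ (inj₁ refl)) eq = <-irrefl (cong depth eq) up<v
      fresh (inj₂ (inj₂ lt))   eq = <-irrefl (cong depth eq) (below lt)
      weaken : ∀ {x} → Bounded u (up v) x → Bounded u v x
      weaken (inj₁ refl)        = inj₁ refl
      weaken (inj₂ (inj₁ refl)) = inj₂ (inj₂ (m≤n⇒m≤o⊔n _ up<v))
      weaken (inj₂ (inj₂ lt))   = inj₂ (inj₂ (m≤n⇒m≤o⊔n _ (below lt)))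

    snocWalk : ∀ {u v w} → Walk A u v → Adj A v w → Walk A u w
    snocWalk here       a = step a here
    snocWalk (step b w) a = step b (snocWalk w a)

    shallow-root : ∀ {u v} → u ∈ R → depth v ≤ depth u → v ∈ R
    shallow-root {u} {v} r v≤u with v ∈? R
    ... | yes r′ = r′
    ... | no v∉  = contradiction
      (<-≤-trans (proj₂ (up-spec v∉)) (≤-trans v≤u (≤-reflexive (depth-root r)))) n≮0

    -- Induction on the sum of the depths: the deeper of two distinct ends is replaced by its
    -- parent. That end is not a root, for otherwise both ends would be roots, and the walk between
    -- them would make them equal.
    connect : ∀ {u v} → Acc _<_ (depth u + depth v) → Walk A u v → SimplePath u v
    connect {u} {v} (acc rs) w with u Fin.≟ v
    ... | yes refl = [ u ] , stop , [] ∷ [] , inj₁ refl ∷ []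
    ... | no u≢v with ≤-total (depth v) (depth u)
    connect {u} {v} (acc rs) w | no u≢v | inj₁ v≤u with u ∈? R
    ... | yes r = contradiction (one-root u v r (shallow-root r v≤u) w) u≢v
    ... | no u∉ with up-spec u∉
    ...   | a , up<u = extendˡ u∉ u≢v v≤u
      (connect (rs (+-monoˡ-< (depth v) up<u)) (step (symmetric a) w))
    connect {u} {v} (acc rs) w | no u≢v | inj₂ u≤v with v ∈? R
    ... | yes r = contradiction (one-root u v (shallow-root r u≤v) r w) u≢v
    ... | no v∉ with up-spec v∉
    ...   | a , up<v = extendʳ v∉ u≢v u≤v
      (connect (rs (+-monoʳ-< (depth u) up<v)) (snocWalk w a))

    adj⇒edge : ∀ {u v} → Adj A u v → Edge Par u v
    adj⇒edge {u} {v} a with connect (<-wellFounded (depth u + depth v)) (step a here)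
    ... | _ , stop          , _   , _ = contradiction a no-loop
    ... | _ , e ∷ stop      , _   , _ = e
    ... | _ , p@(_ ∷ _ ∷ stop) , unq , _ =
      contradiction (_ , _ , s≤s (s≤s z≤n) , unq , closed p (symmetric a)) no-cycle
    ... | _ , p@(_ ∷ _ ∷ _ ∷ _) , unq , _ =
      contradiction (_ , _ , s≤s (s≤s z≤n) , unq , closed p (symmetric a)) no-cycle

  describes : Describes Par A
  describes u v = adj⇒edge , edge⇒adj

abstract
  parentsOf : ∀ {N} {R : Subset N} {A} → IsRootedForest R A →
    ∃ λ (up : Fin N → Fin N) → ∃ λ (depth : Fin N → ℕ) →
      (∀ {v} → v ∉ R → depth (up v) < depth v) ×
      Describes (λ v u → v ∉ R × up v ≡ u) A
  parentsOf forest = up , depth , proj₂ ∘ up-spec , describes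
    where open ToParents forest

-- Partial sums and blocks

S-mono : ∀ {n} (r : Vec ℕ n) {i j} → i ≤ j → S r i ≤ S r j
S-mono r       z≤n       = z≤n
S-mono []      (s≤s _)   = z≤n
S-mono (x ∷ r) (s≤s i≤j) = +-monoʳ-≤ x (S-mono r i≤j)

S-saturated : ∀ {n} (r : Vec ℕ n) {j} → n ≤ j → S r j ≡ S r n
S-saturated []      {zero}  _         = refl
S-saturated []      {suc j} _         = refl
S-saturated (x ∷ r) {suc j} (s≤s n≤j) = cong (x +_) (S-saturated r n≤j)

S-injective : ∀ {n} {r r′ : Vec ℕ n} → (∀ j → S r j ≡ S r′ j) → r ≡ r′
S-injective {r = []}    {[]}     eq = refl
S-injective {r = x ∷ r} {y ∷ r′} eq with +-cancelʳ-≡ 0 x y (eq 1)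
... | refl = cong (x ∷_) (S-injective λ j → +-cancelˡ-≡ x _ _ (eq (suc j)))

differences : ∀ n → (ℕ → ℕ) → Vec ℕ n
differences n T = tabulate λ j → T (suc (toℕ j)) ∸ T (toℕ j)

-- A telescoping sum. `T 0` is kept arbitrary because the induction passes to `T ∘ suc`.
S-differences : ∀ n (T : ℕ → ℕ) → (∀ j → T j ≤ T (suc j)) →
  ∀ {j} → j ≤ n → S (differences n T) j + T 0 ≡ T j
S-differences n       T mono z≤n       = refl
S-differences (suc n) T mono {suc j} (s≤s j≤n) = begin
  (T 1 ∸ T 0 + s) + T 0 ≡⟨ cong (_+ T 0) (+-comm (T 1 ∸ T 0) s) ⟩
  (s + (T 1 ∸ T 0)) + T 0 ≡⟨ +-assoc s _ _ ⟩
  s + (T 1 ∸ T 0 + T 0) ≡⟨ cong (s +_) (m∸n+n≡m (mono 0)) ⟩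
  s + T 1               ≡⟨ S-differences n (T ∘ suc) (mono ∘ suc) j≤n ⟩
  T (suc j)             ∎
  where
  open ≡-Reasoning
  s = S (differences n (T ∘ suc)) j

InBlock : ∀ {n} → Vec ℕ n → ℕ → ℕ → Set
InBlock r x v = S r x ≤ v × v < S r (suc x)

inBlock? : ∀ {n} (r : Vec ℕ n) x v → Dec (InBlock r x v)
inBlock? r x v = (S r x ≤? v) ×-dec (v <? S r (suc x))

module _ {n : ℕ} (r : Vec ℕ n) where

  block-exists : ∀ j {v} → v < S r j → ∃ λ x → InBlock r x v
  block-exists (suc j) {v} v< with v <? S r j
  ... | yes v<′ = block-exists j v<′
  ... | no v≮   = j , ≮⇒≥ v≮ , v<

  block-mono : ∀ {x y v w} → InBlock r x v → InBlock r y w → v ≤ w → x ≤ y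
  block-mono (Sx≤v , _) (_ , w<Sy) v≤w = ≮⇒≥ λ y<x →
    <-irrefl refl (<-≤-trans w<Sy (≤-trans (S-mono r y<x) (≤-trans Sx≤v v≤w)))

  block-strict : ∀ {x y v w} → InBlock r x v → InBlock r y w → x < y → v < w
  block-strict (_ , v<Sx) (Sy≤w , _) x<y = <-≤-trans v<Sx (≤-trans (S-mono r x<y) Sy≤w)

  block-unique : ∀ {x y v} → InBlock r x v → InBlock r y v → x ≡ y
  block-unique a b = ≤-antisym (block-mono a b ≤-refl) (block-mono b a ≤-refl)

  block-bound : ∀ {x v} → InBlock r x v → x < n
  block-bound {x} (Sx≤v , v<S) = ≰⇒> λ n≤x → <-irrefl refl
    (<-≤-trans v<S (≤-trans (≤-reflexive (trans (S-saturated r (m≤n⇒m≤1+n n≤x))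
                                                (sym (S-saturated r n≤x)))) Sx≤v))

-- The hitting times kᵢ of a balanced vector exist automatically: S j - j decreases
-- by at most one at each step, so only the final value and a lower bound matter.

Ballot : ∀ {n} → ℕ → Vec ℕ n → Set
Ballot {n} m r = S r n ≡ m × (∀ {j} → j ≤ n → j ≤ S r j + (n ∸ m))

private
  +-then- : ∀ s i → int (s + i) ℤ.- int i ≡ int s
  +-then- s i = trans (ℤ.+-assoc (int s) (int i) (ℤ.- int i))
    (trans (cong (λ y → int s ℤ.+ y) (ℤ.+-inverseʳ (int i))) (ℤ.+-identityʳ (int s)))

  -then+ : ∀ x i → x ℤ.- int i ℤ.+ int i ≡ x
  -then+ x i = trans (ℤ.+-assoc x (ℤ.- int i) (int i))
    (trans (cong (λ y → x ℤ.+ y) (ℤ.+-inverseˡ (int i))) (ℤ.+-identityʳ x))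

  ≡-fromℤ : ∀ {s k} i → int s ≡ int k ℤ.- int i → k ≡ s + i
  ≡-fromℤ {s} {k} i eq =
    ℤ.+-injective (trans (sym (-then+ (int k) i)) (cong (λ x → x ℤ.+ int i) (sym eq)))

  ≤-fromℤ : ∀ {s j} i → int s ℤ.> int j ℤ.- int i ℤ.- int 1 → j ≤ s + i
  ≤-fromℤ {s} {j} i gt = s≤s⁻¹ (subst (j <_) (cong (_+ i) (+-comm s 1)) (ℤ.drop‿+<+ lt₂))
    where
    lt₁ : int j ℤ.- int i ℤ.< int (s + 1)
    lt₁ = subst (ℤ._< int (s + 1)) (-then+ (int j ℤ.- int i) 1) (ℤ.+-monoˡ-< (int 1) gt)
    lt₂ : int j ℤ.< int (s + 1 + i)
    lt₂ = subst (ℤ._< int (s + 1 + i)) (-then+ (int j) i) (ℤ.+-monoˡ-< (int i) lt₁)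

  ≤-toℤ : ∀ {s j} i → j ≤ s + i → int s ℤ.> int j ℤ.- int i ℤ.- int 1
  ≤-toℤ {s} {j} i j≤ = subst (int j ℤ.- int i ℤ.- int 1 ℤ.<_) (+-then- s 1) (ℤ.+-monoˡ-< (ℤ.- int 1) lt)
    where
    lt : int j ℤ.- int i ℤ.< int (s + 1)
    lt = subst (int j ℤ.- int i ℤ.<_) (+-then- (s + 1) i)
      (ℤ.+-monoˡ-< (ℤ.- int i) (+<+ (subst (j <_) (cong (_+ i) (+-comm 1 s)) (s≤s j≤))))

enclosing : ∀ (ks : ℕ → ℕ) → ks 0 ≡ 0 → ∀ b {j} → j < ks (suc b) →
  ∃ λ i → i ≤ b × ks i ≤ j × j < ks (suc i)
enclosing ks z zero    j< = 0 , z≤n , subst (_≤ _) (sym z) z≤n , j<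
enclosing ks z (suc b) {j} j< with j <? ks (suc b)
... | no j≮   = suc b , ≤-refl , ≮⇒≥ j≮ , j<
... | yes j<′ with enclosing ks z b j<′
...   | i , i≤b , lo , hi = i , m≤n⇒m≤1+n i≤b , lo , hi

-- Each `j ≤ n` lies in some interval `ks i ≤ j < ks (suc i)`, where balancedness yields
-- `j ≤ S r j + i`; the weakest of these bounds is the one for `i = n ∸ m`.
balanced⇒ballot : ∀ {n m} {r : Vec ℕ n} → Balanced m r → Ballot m r
balanced⇒ballot {n} {m} {r} (ks , k0 , kend , _ , hit , above , total) = total , bound
  where
  bound : ∀ {j} → j ≤ n → j ≤ S r j + (n ∸ m)
  bound {j} j≤n with enclosing ks k0 (n ∸ m) (subst (j <_) (sym kend) (s≤s j≤n))
  ... | i , i≤ , lo , hi = ≤-trans (below i i≤ lo hi) (+-monoʳ-≤ (S r j) i≤)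
    where
    below : ∀ i → i ≤ n ∸ m → ks i ≤ j → j < ks (suc i) → j ≤ S r j + i
    below i i≤ lo hi with m≤n⇒m<n∨m≡n lo
    ... | inj₁ ki<j = ≤-fromℤ i (above i j i≤ ki<j hi)
    below zero i≤ lo hi | inj₂ eq = subst (_≤ S r j + 0) (trans (sym k0) eq) z≤n
    below (suc i) i≤ lo hi | inj₂ refl = ≤-reflexive (≡-fromℤ (suc i) (hit (suc i) (s≤s z≤n) i≤))

ballot⇒balanced : ∀ {n m} {r : Vec ℕ n} → m ≤ n → Ballot m r → Balanced m r
ballot⇒balanced {n} {m} {r} m≤n (total , bound) =
  ks , ks-zero , ks-end , (λ i _ → ks-increasing i) , ks-hit , ks-between , total
  where
  Reached : ℕ → ℕ → Set
  Reached i j = S r j + i ≤ j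

  eventually : ∀ i → Reached i (n + (m + i))
  eventually i = ≤-trans
    (≤-reflexive (cong (_+ i) (trans (S-saturated r (m≤m+n n (m + i))) total)))
    (m≤n+m (m + i) n)

  abstract
    hitting : ∀ i → Least (Reached i)
    hitting i = least (λ j → S r j + i ≤? j) (eventually i)

  ks : ℕ → ℕ
  ks i = proj₁ (hitting i)

  ks-reached : ∀ i → Reached i (ks i)
  ks-reached i = proj₁ (proj₂ (hitting i))

  ks-least : ∀ i {j} → Reached i j → ks i ≤ j
  ks-least i = proj₂ (proj₂ (hitting i))

  -- As `S r` is monotone, `j - S r j` grows by at most one per step. Hence the first time it
  -- reaches a level it hits that level exactly, and higher levels are reached strictly later.
  previous : ∀ {i j} → S r (suc j) + i ≤ j → Reached i j
  previous {i} {j} le = ≤-trans (+-monoˡ-≤ i (S-mono r (n≤1+n j))) le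

  ks-exact : ∀ i → S r (ks i) + i ≡ ks i
  ks-exact i with m≤n⇒m<n∨m≡n (ks-reached i)
  ... | inj₂ eq = eq
  ... | inj₁ lt with ks i | ks-least i
  ...   | suc j | min = contradiction (min (previous (s≤s⁻¹ lt))) (<-irrefl refl)

  ks-zero : ks 0 ≡ 0
  ks-zero = n≤0⇒n≡0 (ks-least 0 z≤n)

  ks-increasing : ∀ i → ks i < ks (suc i)
  ks-increasing i with ks (suc i) | ks-reached (suc i)
  ... | zero  | le = contradiction le λ ()
  ... | suc j | le = s≤s (ks-least i (previous (s≤s⁻¹ (subst (_≤ suc j) (+-suc _ i) le))))

  end-reached : Reached (suc (n ∸ m)) (suc n)
  end-reached = ≤-reflexive (trans
    (cong (_+ suc (n ∸ m)) (trans (S-saturated r (n≤1+n n)) total))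
    (trans (+-suc m (n ∸ m)) (cong suc (m+[n∸m]≡n m≤n))))

  -- The time `suc n` is one past the end of `r`, where the partial sum is still `m`; the ballot
  -- bound excludes all earlier times.
  ks-end : ks (suc (n ∸ m)) ≡ suc n
  ks-end = ≤-antisym (ks-least _ end-reached) (≰⇒> λ k≤n →
    <-irrefl refl (≤-trans (≤-reflexive (sym (+-suc _ _)))
      (≤-trans (ks-reached (suc (n ∸ m))) (bound k≤n))))

  ks-hit : ∀ i → 1 ≤ i → i ≤ n ∸ m → int (S r (ks i)) ≡ int (ks i) ℤ.- int i
  ks-hit i _ _ = trans (sym (+-then- (S r (ks i)) i)) (cong (λ k → int k ℤ.- int i) (ks-exact i))

  ks-between : ∀ i j → i ≤ n ∸ m → ks i < j → j < ks (suc i) → int (S r j) ℤ.> int j ℤ.- int i ℤ.- int 1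
  ks-between i j _ _ j< = ≤-toℤ i (s≤s⁻¹ (≰⇒> λ le →
    <⇒≱ j< (ks-least (suc i) (subst (_≤ j) (sym (+-suc _ i)) le))))

-- Permutations and cardinalities

injective⇒surjective : ∀ {m} {f : Fin m → Fin m} → Injective _≡_ _≡_ f → ∀ j → ∃ λ i → f i ≡ j
injective⇒surjective {suc m} {f} inj j with Fin.any? (λ i → f i Fin.≟ j)
... | yes hit = hit
... | no miss = contradiction
  (Fin.injective⇒≤ λ {i} {i′} eq → inj (Fin.punchOut-injective (avoids i) (avoids i′) eq))
  1+n≰n
  where
  avoids : ∀ i → j ≢ f i
  avoids i eq = miss (i , sym eq)

perm-surjective : ∀ {m} (σ : Vec (Fin m) m) → IsPerm σ → ∀ {v} → v < m → ∃ λ i → toℕ (lookup σ i) ≡ v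
perm-surjective σ perm v<m with injective⇒surjective (λ {i} {j} → perm i j) (fromℕ< v<m)
... | i , eq = i , trans (cong toℕ eq) (Fin.toℕ-fromℕ< v<m)

-- All values below `x` are attained by `σ`, so `τ` rises strictly along a chain of `x` steps ending
-- at `i`. Used in both directions, this shows that two permutations inducing the same order are
-- equal.
perm-≤ : ∀ {m} (σ τ : Vec (Fin m) m) → IsPerm σ →
  (∀ {i j} → lookup σ i Fin.< lookup σ j → lookup τ i Fin.< lookup τ j) →
  ∀ x i → toℕ (lookup σ i) ≡ x → x ≤ toℕ (lookup τ i)
perm-≤ σ τ perm mono zero    i eq = z≤n
perm-≤ {m} σ τ perm mono (suc x) i eq
  with perm-surjective σ perm {x} (<-trans (n<1+n x) (subst (_< m) eq (Fin.toℕ<n (lookup σ i))))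
... | j , eq′ = ≤-<-trans (perm-≤ σ τ perm mono x j eq′)
  (mono (≤-reflexive (trans (cong suc eq′) (sym eq))))

comprehension : ∀ {m} {P : Fin m → Set} → (∀ i → Dec (P i)) → Subset m
comprehension P? = tabulate (does ∘ P?)

module _ {m : ℕ} {P : Fin m → Set} (P? : ∀ i → Dec (P i)) where

  ∈-comprehension⁺ : ∀ {i} → P i → i ∈ comprehension P?
  ∈-comprehension⁺ {i} p = lookup⇒[]= i _ (trans (lookup∘tabulate _ i) (dec-true (P? i) p))

  ∈-comprehension⁻ : ∀ {i} → i ∈ comprehension P? → P i
  ∈-comprehension⁻ {i} i∈ = does⇒ (P? i) (trans (sym (lookup∘tabulate _ i)) ([]=⇒lookup i∈))

  card : ℕ
  card = ∣ comprehension P? ∣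

  card-full : (∀ i → P i) → card ≡ m
  card-full all = ≤-antisym (∣p∣≤n (comprehension P?))
    (subst (_≤ card) (∣⊤∣≡n m) (p⊆q⇒∣p∣≤∣q∣ {p = ⊤} λ _ → ∈-comprehension⁺ (all _)))

  card-< : ∀ {i} → ¬ P i → card < m
  card-< {i} ¬p = subst (card <_) (∣⊤∣≡n m)
    (p⊂q⇒∣p∣<∣q∣ {q = ⊤} ((λ _ → ∈⊤) , i , ∈⊤ , ¬p ∘ ∈-comprehension⁻))

module _ {m : ℕ} {P Q : Fin m → Set} (P? : ∀ i → Dec (P i)) (Q? : ∀ i → Dec (Q i))
         (P⇒Q : ∀ {i} → P i → Q i) where

  private
    included : comprehension P? ⊆ comprehension Q?
    included = ∈-comprehension⁺ Q? ∘ P⇒Q ∘ ∈-comprehension⁻ P?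

  card-mono : card P? ≤ card Q?
  card-mono = p⊆q⇒∣p∣≤∣q∣ included

  card-strict : ∀ {i} → Q i → ¬ P i → card P? < card Q?
  card-strict q ¬p = p⊂q⇒∣p∣<∣q∣
    (included , _ , ∈-comprehension⁺ Q? q , ¬p ∘ ∈-comprehension⁻ P?)

card-empty : ∀ {m} {P : Fin m → Set} (P? : ∀ i → Dec (P i)) → (∀ i → ¬ P i) → card P? ≡ 0
card-empty {zero}  P? none = refl
card-empty {suc m} P? none with P? Fin.zero
... | yes p = contradiction p (none Fin.zero)
... | no _  = card-empty (P? ∘ Fin.suc) (none ∘ Fin.suc)

-- Breadth-first codes

OrderedAt : ∀ {m n} → Vec ℕ n → Vec (Fin m) m → ℕ → Fin m → Fin m → Set
OrderedAt r σ x i j = i Fin.< j → InBlock r x (toℕ (lookup σ i)) →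
  InBlock r x (toℕ (lookup σ j)) → lookup σ i Fin.< lookup σ j

Ordered : ∀ {m n} → Vec ℕ n → Vec (Fin m) m → Set
Ordered r σ = ∀ {x i j} → OrderedAt r σ x i j

-- The decidable form of the conditions in `𝒞`: `Balanced` asks for a function `ℕ → ℕ`, which cannot
-- be searched for directly.
record Valid {m n : ℕ} (r : Vec ℕ n) (σ : Vec (Fin m) m) : Set where
  field
    perm    : IsPerm σ
    ordered : Ordered r σ
    ballot  : Ballot m r

module Codes {k m n : ℕ} (k≡ : suc (n ∸ m) ≡ k) (k+m≡ : k + m ≡ suc n) where

  W : Set
  W = Fin k ⊎ Fin m

  position : Vec (Fin m) m → W → ℕ
  position σ (inj₁ a) = toℕ a
  position σ (inj₂ i) = k + toℕ (lookup σ i)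

  data ParW (r : Vec ℕ n) (σ : Vec (Fin m) m) : W → W → Set where
    block : ∀ {i w} → InBlock r (position σ w) (toℕ (lookup σ i)) → ParW r σ (inj₂ i) w

  parW? : ∀ r σ → Decidable (ParW r σ)
  parW? r σ (inj₁ a) w = no λ ()
  parW? r σ (inj₂ i) w =
    map′ block (λ { (block b) → b }) (inBlock? r (position σ w) (toℕ (lookup σ i)))

  root<nonroot : ∀ (a : Fin k) x → toℕ a < k + x
  root<nonroot a x = <-≤-trans (Fin.toℕ<n a) (m≤m+n k x)

  module Positions (σ : Vec (Fin m) m) (perm : IsPerm σ) where

    pos : W → ℕ
    pos = position σ

    pos-injective : ∀ {u v} → pos u ≡ pos v → u ≡ v
    pos-injective {inj₁ a} {inj₁ b} eq = cong inj₁ (Fin.toℕ-injective eq)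
    pos-injective {inj₁ a} {inj₂ j} eq = contradiction (root<nonroot a _) (<-irrefl eq)
    pos-injective {inj₂ i} {inj₁ b} eq = contradiction (root<nonroot b _) (<-irrefl (sym eq))
    pos-injective {inj₂ i} {inj₂ j} eq =
      cong inj₂ (perm i j (Fin.toℕ-injective (+-cancelˡ-≡ k _ _ eq)))

    pos-surjective : ∀ {x} → x ≤ n → ∃ λ w → pos w ≡ x
    pos-surjective {x} x≤n with x <? k
    ... | yes x<k = inj₁ (fromℕ< x<k) , Fin.toℕ-fromℕ< x<k
    ... | no x≮k with perm-surjective σ perm {x ∸ k}
                        (+-cancelˡ-< k _ _ (subst₂ _<_ (sym (m+[n∸m]≡n (≮⇒≥ x≮k))) (sym k+m≡) (s≤s x≤n)))
    ...   | i , eq = inj₂ i , trans (cong (k +_) eq) (m+[n∸m]≡n (≮⇒≥ x≮k))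

  module Code {r : Vec ℕ n} {σ : Vec (Fin m) m} (valid : Valid r σ) where
    open Valid valid public
    open Positions σ perm public

    par-exists : ∀ i → ∃ (ParW r σ (inj₂ i))
    par-exists i with block-exists r n (subst (_ <_) (sym (proj₁ ballot)) (Fin.toℕ<n (lookup σ i)))
    ... | x , blk with pos-surjective (<⇒≤ (block-bound r blk))
    ...   | w , refl = w , block blk

    par-unique : ∀ {v u w} → ParW r σ v u → ParW r σ v w → u ≡ w
    par-unique (block a) (block b) = pos-injective (block-unique r a b)

    -- When the vertex in place `x` (counted from 0) is served, the list holds the `k` roots and the
    -- `S r x` children of earlier vertices. With `k = suc (n ∸ m)` the ballot bound reads
    -- `x < k + S r x`, and the children of that vertex start at place `k + S r x`.
    par-descends : ∀ {v u} → ParW r σ v u → pos u < pos v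
    par-descends {_} {u} (block blk@(Sx≤v , _)) = <-≤-trans
      (≤-trans (s≤s (proj₂ ballot (<⇒≤ (block-bound r blk))))
               (≤-reflexive (trans (sym (+-suc _ (n ∸ m))) (trans (cong (S r (pos u) +_) k≡) (+-comm _ k)))))
      (+-monoʳ-≤ k Sx≤v)

  -- Uniqueness of the code with a given edge set

  module Compare {r r′ : Vec ℕ n} {σ σ′ : Vec (Fin m) m} (valid : Valid r σ) (valid′ : Valid r′ σ′)
                 (edges : ∀ {u v} → Edge (ParW r σ) u v → Edge (ParW r′ σ′) u v) where
    private
      module X = Code valid
      module Y = Code valid′

    -- Suppose the edge from `v` to its parent `u` is reversed in the second code. Then `u` is not a
    -- root and has a parent `w` in the first code, by induction also in the second, so `w` is `v`.
    -- But in the first code `w` comes before `u` and `u` before `v`.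
    par⇒par : ∀ {v u} → ParW r σ v u → ParW r′ σ′ v u
    par⇒par = go (<-wellFounded _)
      where
      go : ∀ {v u} → Acc _<_ (X.pos v) → ParW r σ v u → ParW r′ σ′ v u
      go {v} {u} (acc rs) p with edges (inj₁ p)
      ... | inj₁ q = q
      go {v} {inj₂ j} (acc rs) p | inj₂ q with X.par-exists j
      ... | w , p′ with Y.par-unique q (go (rs (X.par-descends p)) p′)
      ...   | refl = contradiction (X.par-descends p′) (<-asym (X.par-descends p))

    -- Non-roots with different parents are ordered as their parents, and siblings as their labels.
    -- Both rules refer only to the parent relation, which the two codes share.
    pos-mono : ∀ {u v} → X.pos u < X.pos v → Y.pos u < Y.pos v
    pos-mono {u} {v} = go {u} {v} (<-wellFounded _)
      where
      go : ∀ {u v} → Acc _<_ (X.pos v) → X.pos u < X.pos v → Y.pos u < Y.pos v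
      go {inj₁ a} {inj₁ b} _ lt = lt
      go {inj₁ a} {inj₂ j} _ lt = root<nonroot a _
      go {inj₂ i} {inj₁ b} _ lt = contradiction (root<nonroot b _) (<-asym lt)
      go {inj₂ i} {inj₂ j} (acc rs) lt with X.par-exists i | X.par-exists j
      ... | u , P@(block p) | v , Q@(block q) with par⇒par P | par⇒par Q
      ...   | block p′ | block q′
        with m≤n⇒m<n∨m≡n (block-mono r p q (<⇒≤ (+-cancelˡ-< k _ _ lt)))
      ...   | inj₁ u<v = +-monoʳ-< k (block-strict r′ p′ q′ (go {u} {v} (rs (X.par-descends Q)) u<v))
      ...   | inj₂ u≡v with X.pos-injective {u} {v} u≡v | Fin.<-cmp i j
      ...     | refl | tri< i<j _ _ = +-monoʳ-< k (Y.ordered i<j p′ q′)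
      ...     | refl | tri≈ _ refl _ = contradiction lt (<-irrefl refl)
      ...     | refl | tri> _ _ j<i = contradiction (+-monoʳ-< k (X.ordered j<i q p)) (<-asym lt)

    σ-≤ : ∀ i → lookup σ i Fin.≤ lookup σ′ i
    σ-≤ i = perm-≤ σ σ′ X.perm
      (λ {i} {j} lt → +-cancelˡ-< k _ _ (pos-mono {inj₂ i} {inj₂ j} (+-monoʳ-< k lt))) _ i refl

  -- If `S r′ j < S r j`, the value `S r′ j` lies in a block of `r` with index below `j`, but in no
  -- such block of `r′`, although the parents agree.
  S-≤ : ∀ {r r′ : Vec ℕ n} {σ : Vec (Fin m) m} → Valid r σ → Valid r′ σ →
    (∀ {v u} → ParW r σ v u → ParW r′ σ v u) → ∀ j → S r j ≤ S r′ j
  S-≤ {r} {r′} {σ} valid valid′ par j = ≮⇒≥ λ lt → absurd lt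
    where
    module X = Code valid
    S≤m : S r j ≤ m
    S≤m with ≤-total j n
    ... | inj₁ j≤n = subst (S r j ≤_) (proj₁ X.ballot) (S-mono r j≤n)
    ... | inj₂ n≤j = ≤-reflexive (trans (S-saturated r n≤j) (proj₁ X.ballot))
    absurd : ¬ S r′ j < S r j
    absurd lt with perm-surjective σ X.perm (<-≤-trans lt S≤m)
    ... | i , eq with X.par-exists i
    ...   | w , P@(block p) with par P | j ≤? X.pos w
    ...     | _        | yes j≤ = <-irrefl refl (<-≤-trans lt (≤-trans (S-mono r j≤) (≤-trans (proj₁ p) (≤-reflexive eq))))
    ...     | block p′ | no j≰  = <-irrefl eq
      (<-≤-trans (proj₂ p′) (S-mono r′ (≰⇒> j≰)))

  code-unique : ∀ {r r′ : Vec ℕ n} {σ σ′ : Vec (Fin m) m} → Valid r σ → Valid r′ σ′ →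
    (∀ {u v} → Edge (ParW r σ) u v → Edge (ParW r′ σ′) u v) →
    (∀ {u v} → Edge (ParW r′ σ′) u v → Edge (ParW r σ) u v) →
    r ≡ r′ × σ ≡ σ′
  code-unique {r} {r′} {σ} {σ′} valid valid′ to from = same-r (lookup-injective same-σ) , lookup-injective same-σ
    where
    module To   = Compare valid valid′ to
    module From = Compare valid′ valid from
    same-σ : ∀ i → lookup σ i ≡ lookup σ′ i
    same-σ i = Fin.toℕ-injective (≤-antisym (To.σ-≤ i) (From.σ-≤ i))
    same-r : σ ≡ σ′ → r ≡ r′
    same-r refl = S-injective λ j → ≤-antisym
      (S-≤ valid valid′ To.par⇒par j)
      (S-≤ valid′ valid From.par⇒par j)

  -- Existence: the code of a parent map

  module Encode (p : Fin m → W) (h : W → ℕ) (h-descends : ∀ i → h (p i) < h (inj₂ i)) where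

    infix 4 _≺_ _≺?_

    -- The order in which breadth-first search visits the vertices.
    data _≺_ : W → W → Set where
      roots    : ∀ {a b} → a Fin.< b → inj₁ a ≺ inj₁ b
      root-non : ∀ {a i} → inj₁ a ≺ inj₂ i
      parents  : ∀ {i j} → p i ≺ p j → inj₂ i ≺ inj₂ j
      siblings : ∀ {i j} → p i ≡ p j → i Fin.< j → inj₂ i ≺ inj₂ j

    ≺-trans : ∀ {u v w} → u ≺ v → v ≺ w → u ≺ w
    ≺-trans (roots a<b)      (roots b<c)      = roots (<-trans a<b b<c)
    ≺-trans (roots _)        root-non         = root-non
    ≺-trans root-non         (parents _)      = root-non
    ≺-trans root-non         (siblings _ _)   = root-non
    ≺-trans (parents a)      (parents b)      = parents (≺-trans a b)
    ≺-trans (parents {i} a)  (siblings e _)   = parents (subst (p i ≺_) e a)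
    ≺-trans (siblings e _)   (parents {_} {j} b) = parents (subst (_≺ p j) (sym e) b)
    ≺-trans (siblings e i<j) (siblings f j<k) = siblings (trans e f) (<-trans i<j j<k)

    ≺-irrefl : ∀ {u} → ¬ u ≺ u
    ≺-irrefl (roots a<a)      = <-irrefl refl a<a
    ≺-irrefl (parents a)      = ≺-irrefl a
    ≺-irrefl (siblings _ i<i) = <-irrefl refl i<i

    data Comparison (u v : W) : Set where
      before : u ≺ v → Comparison u v
      equal  : u ≡ v → Comparison u v
      after  : v ≺ u → Comparison u v

    compare : ∀ u v → Acc _<_ (h u) → Comparison u v
    compare (inj₁ a) (inj₁ b) _ with Fin.<-cmp a b
    ... | tri< a<b _ _  = before (roots a<b)
    ... | tri≈ _ refl _ = equal refl
    ... | tri> _ _ b<a  = after (roots b<a)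
    compare (inj₁ a) (inj₂ j) _ = before root-non
    compare (inj₂ i) (inj₁ b) _ = after root-non
    compare (inj₂ i) (inj₂ j) (acc rs) with compare (p i) (p j) (rs (h-descends i))
    ... | before lt = before (parents lt)
    ... | after  gt = after (parents gt)
    ... | equal  eq with Fin.<-cmp i j
    ...   | tri< i<j _ _  = before (siblings eq i<j)
    ...   | tri≈ _ refl _ = equal refl
    ...   | tri> _ _ j<i  = after (siblings (sym eq) j<i)

    _≺?_ : Decidable _≺_
    u ≺? v with compare u v (<-wellFounded (h u))
    ... | before lt   = yes lt
    ... | equal  refl = no ≺-irrefl
    ... | after  gt   = no λ lt → ≺-irrefl (≺-trans lt gt)

    -- If the parent is itself a non-root, it precedes its child because, by recursion, the
    -- grandparent precedes the parent. The chain ends at a root, which precedes every non-root.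
    parent≺ : ∀ i → p i ≺ inj₂ i
    parent≺ i = go (p i) refl (<-wellFounded (h (p i)))
      where
      go : ∀ {i} u → p i ≡ u → Acc _<_ (h u) → u ≺ inj₂ i
      go (inj₁ a) eq _        = root-non
      go (inj₂ j) eq (acc rs) =
        parents (subst (p j ≺_) (sym eq) (go (p j) refl (rs (h-descends j))))

    rank : Fin m → ℕ
    rank i = card (λ j → inj₂ j ≺? inj₂ i)

    rank<m : ∀ i → rank i < m
    rank<m i = card-< (λ j → inj₂ j ≺? inj₂ i) ≺-irrefl

    rank-mono : ∀ {i j} → inj₂ i ≺ inj₂ j → rank i < rank j
    rank-mono {i} {j} lt =
      card-strict (λ l → inj₂ l ≺? inj₂ i) (λ l → inj₂ l ≺? inj₂ j) (λ lt′ → ≺-trans lt′ lt) lt ≺-irrefl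

    σ : Vec (Fin m) m
    σ = tabulate λ i → fromℕ< (rank<m i)

    σ-rank : ∀ i → toℕ (lookup σ i) ≡ rank i
    σ-rank i = trans (cong toℕ (lookup∘tabulate _ i)) (Fin.toℕ-fromℕ< (rank<m i))

    ≺⇒< : ∀ {u v} → u ≺ v → position σ u < position σ v
    ≺⇒< (roots a<b)      = a<b
    ≺⇒< (root-non {a})   = root<nonroot a _
    ≺⇒< lt@(parents {i} {j} _)    =
      +-monoʳ-< k (subst₂ _<_ (sym (σ-rank i)) (sym (σ-rank j)) (rank-mono lt))
    ≺⇒< lt@(siblings {i} {j} _ _) =
      +-monoʳ-< k (subst₂ _<_ (sym (σ-rank i)) (sym (σ-rank j)) (rank-mono lt))

    <⇒≺ : ∀ {u v} → position σ u < position σ v → u ≺ v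
    <⇒≺ {u} {v} lt with compare u v (<-wellFounded (h u))
    ... | before u≺v = u≺v
    ... | equal refl = contradiction lt (<-irrefl refl)
    ... | after v≺u  = contradiction lt (<-asym (≺⇒< v≺u))

    perm : IsPerm σ
    perm i j eq with compare (inj₂ i) (inj₂ j) (<-wellFounded (h (inj₂ i)))
    ... | before lt  = contradiction (≺⇒< lt) (<-irrefl (cong (λ s → k + toℕ s) eq))
    ... | equal refl = refl
    ... | after gt   = contradiction (≺⇒< gt) (<-irrefl (cong (λ s → k + toℕ s) (sym eq)))

    open Positions σ perm

    pos-parent< : ∀ i → pos (p i) < n
    pos-parent< i = <-≤-trans (≺⇒< (parent≺ i)) (s≤s⁻¹
      (subst (pos (inj₂ i) <_) k+m≡ (+-monoʳ-< k (Fin.toℕ<n (lookup σ i)))))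

    placed? : ∀ x i → Dec (pos (p i) < x)
    placed? x i = pos (p i) <? x

    -- The value that `S r x` has to take, namely the number of children of the vertices in the
    -- places below `x`; `r` is obtained from it by differences.
    placed : ℕ → ℕ
    placed x = card (placed? x)

    r : Vec ℕ n
    r = differences n placed

    S-placed : ∀ {x} → x ≤ n → S r x ≡ placed x
    S-placed {x} x≤n = begin
      S r x            ≡⟨ +-identityʳ _ ⟨
      S r x + 0        ≡⟨ cong (S r x +_) (card-empty (placed? 0) λ _ ()) ⟨
      S r x + placed 0 ≡⟨ S-differences n placed
                            (λ y → card-mono (placed? y) (placed? (suc y)) m≤n⇒m≤1+n) x≤n ⟩
      placed x         ∎
      where open ≡-Reasoning

    -- The children of vertices listed before `p i` all precede `i`, which gives the lower bound.
    -- Whatever non-root precedes `i` has a parent no later than `p i`, and `i` itself is one more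
    -- child of `p i`, which makes the upper bound strict.
    in-block : ∀ i → InBlock r (pos (p i)) (toℕ (lookup σ i))
    in-block i =
      subst₂ _≤_ (sym (S-placed (<⇒≤ (pos-parent< i)))) (sym (σ-rank i))
        (card-mono (placed? _) (λ j → inj₂ j ≺? inj₂ i) (parents ∘ <⇒≺)) ,
      subst₂ _<_ (sym (σ-rank i)) (sym (S-placed (pos-parent< i)))
        (card-strict (λ j → inj₂ j ≺? inj₂ i) (placed? _) parent-≤ (n<1+n _) ≺-irrefl)
      where
      parent-≤ : ∀ {j} → inj₂ j ≺ inj₂ i → pos (p j) < suc (pos (p i))
      parent-≤ (parents lt)    = m≤n⇒m≤1+n (≺⇒< lt)
      parent-≤ (siblings eq _) = s≤s (≤-reflexive (cong pos eq))

    ordered : Ordered r σ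
    ordered {x} {i} {j} i<j bi bj = +-cancelˡ-< k _ _ (≺⇒< (siblings same-parent i<j))
      where
      same-parent : p i ≡ p j
      same-parent = pos-injective (trans (block-unique r (in-block i) bi)
                                         (block-unique r bj (in-block j)))

    -- A root in place `x` gives `x ≤ n ∸ m` at once. If the non-root `i` is in place `x`, then `i`
    -- and its `rank i` predecessors all have parents before `x`, so `placed x` exceeds `rank i`.
    ballot : Ballot m r
    ballot = trans (S-placed ≤-refl) (card-full (placed? n) pos-parent<) , bound
      where
      bound : ∀ {x} → x ≤ n → x ≤ S r x + (n ∸ m)
      bound {x} x≤n with pos-surjective x≤n
      ... | inj₁ a , refl = ≤-trans (s≤s⁻¹ (subst (toℕ a <_) (sym k≡) (Fin.toℕ<n a))) (m≤n+m _ _)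
      ... | inj₂ i , refl = begin
        k + toℕ (lookup σ i)    ≡⟨ cong₂ _+_ (sym k≡) (σ-rank i) ⟩
        suc (n ∸ m) + rank i    ≡⟨ +-suc (n ∸ m) (rank i) ⟨
        (n ∸ m) + suc (rank i)  ≤⟨ +-monoʳ-≤ (n ∸ m) (card-strict (λ j → inj₂ j ≺? inj₂ i) (placed? x)
                                     (λ lt → ≺⇒< (≺-trans (parent≺ _) lt)) (≺⇒< (parent≺ i)) ≺-irrefl) ⟩
        (n ∸ m) + placed x      ≡⟨ +-comm (n ∸ m) _ ⟩
        placed x + (n ∸ m)      ≡⟨ cong (_+ (n ∸ m)) (S-placed x≤n) ⟨
        S r x + (n ∸ m)         ∎
        where open ≤-Reasoning

    valid : Valid r σ
    valid = record { perm = perm ; ordered = ordered ; ballot = ballot }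

    par : ∀ i → ParW r σ (inj₂ i) (p i)
    par i = block (in-block i)

  abstract
    encodeParents : (p : Fin m → W) (h : W → ℕ) → (∀ i → h (p i) < h (inj₂ i)) →
      ∃ λ r → ∃ λ σ → Valid r σ × (∀ i → ParW r σ (inj₂ i) (p i))
    encodeParents p h h-descends = r , σ , valid , par
      where open Encode p h h-descends

-- The forest proof in an element of ℱ is irrelevant, so the code of a forest has to be
-- found by a finite search; the proof only shows that the search succeeds.

ordered-blocks : ∀ {m n} (r : Vec ℕ n) (σ : Vec (Fin m) m) →
  (∀ (x : Fin n) i j → OrderedAt r σ (toℕ x) i j) → Ordered r σ
ordered-blocks r σ ord {x} {i} {j} i<j bi = subst (λ y → OrderedAt r σ y i j)
  (Fin.toℕ-fromℕ< x<n) (ord (fromℕ< x<n) i j) i<j bi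
  where x<n = block-bound r bi

compatible⇒ordered : ∀ {m n} (r : Vec ℕ n) (σ : Vec (Fin m) m) → Compatible r σ → Ordered r σ
compatible⇒ordered r σ compat = ordered-blocks r σ
  λ { x i j i<j (a , b) (c , d) → proj₂ (compat x) i j i<j a b c d }

ordered⇒compatible : ∀ {m n} (r : Vec ℕ n) (σ : Vec (Fin m) m) →
  S r n ≡ m → Ordered r σ → Compatible r σ
ordered⇒compatible r σ total ord x =
  (λ v _ v< → <-≤-trans v< (subst (S r (suc (toℕ x)) ≤_) total (S-mono r (Fin.toℕ<n x)))) ,
  (λ i j i<j a b c d → ord i<j (a , b) (c , d))

valid? : ∀ {m n} (r : Vec ℕ n) (σ : Vec (Fin m) m) → Dec (Valid r σ)
valid? {m} {n} r σ =
  map′ (λ { (p , o , b) → record { perm = p ; ordered = ordered-blocks r σ o ; ballot = b } })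
       (λ v → Valid.perm v , (λ x i j → Valid.ordered v) , Valid.ballot v)
       (perm? ×-dec ordered? ×-dec ballot?)
  where
  perm? : Dec (IsPerm σ)
  perm? = Fin.all? λ i → Fin.all? λ j → (lookup σ i Fin.≟ lookup σ j) →-dec (i Fin.≟ j)

  ordered? : Dec (∀ (x : Fin n) i j → OrderedAt r σ (toℕ x) i j)
  ordered? = Fin.all? λ x → Fin.all? λ i → Fin.all? λ j →
    (i Fin.<? j) →-dec inBlock? r (toℕ x) _ →-dec inBlock? r (toℕ x) _ →-dec
    (lookup σ i Fin.<? lookup σ j)

  ballot? : Dec (Ballot m r)
  ballot? = (S r n ≟ m) ×-dec map′
    (λ b {j} j≤n → subst (λ j → j ≤ S r j + (n ∸ m)) (Fin.toℕ-fromℕ< (s≤s j≤n)) (b (fromℕ< (s≤s j≤n))))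
    (λ b j → b (s≤s⁻¹ (Fin.toℕ<n j)))
    (Fin.all? {n = suc n} λ j → toℕ j ≤? S r (toℕ j) + (n ∸ m))

anyVec? : ∀ {a l} {P : Vec (Fin a) l → Set} → (∀ v → Dec (P v)) → Dec (∃ P)
anyVec? {l = zero}  P? = map′ ([] ,_) (λ { ([] , p) → p }) (P? [])
anyVec? {l = suc l} P? = map′ (λ { (x , v , p) → x ∷ v , p }) (λ { (x ∷ v , p) → x , v , p })
  (Fin.any? λ x → anyVec? λ v → P? (x ∷ v))

-- Makes the search for `r` finite: entries with sum at most `b` are elements of `Fin (suc b)`.
bounded-entries : ∀ {n b} (r : Vec ℕ n) → S r n ≤ b → ∃ λ (r̂ : Vec (Fin (suc b)) n) → map toℕ r̂ ≡ r
bounded-entries []      _  = [] , refl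
bounded-entries (x ∷ r) le with bounded-entries r (≤-trans (m≤n+m _ x) le)
... | r̂ , eq = fromℕ< (s≤s (≤-trans (m≤m+n x _) le)) ∷ r̂ , cong₂ _∷_ (Fin.toℕ-fromℕ< _) eq

-- Splitting the vertices into roots and non-roots

vertex : ∀ {N} (R : Subset N) → Fin ∣ R ∣ ⊎ Fin ∣ ∁ R ∣ → Fin N
vertex (true  ∷ R) (inj₁ Fin.zero)    = Fin.zero
vertex (true  ∷ R) (inj₁ (Fin.suc a)) = Fin.suc (vertex R (inj₁ a))
vertex (true  ∷ R) (inj₂ i)           = Fin.suc (vertex R (inj₂ i))
vertex (false ∷ R) (inj₁ a)           = Fin.suc (vertex R (inj₁ a))
vertex (false ∷ R) (inj₂ Fin.zero)    = Fin.zero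
vertex (false ∷ R) (inj₂ (Fin.suc i)) = Fin.suc (vertex R (inj₂ i))

classify : ∀ {N} (R : Subset N) → Fin N → Fin ∣ R ∣ ⊎ Fin ∣ ∁ R ∣
classify (true  ∷ R) Fin.zero    = inj₁ Fin.zero
classify (true  ∷ R) (Fin.suc v) = Sum.map₁ Fin.suc (classify R v)
classify (false ∷ R) Fin.zero    = inj₂ Fin.zero
classify (false ∷ R) (Fin.suc v) = Sum.map₂ Fin.suc (classify R v)

classify-vertex : ∀ {N} (R : Subset N) w → classify R (vertex R w) ≡ w
classify-vertex (true  ∷ R) (inj₁ Fin.zero)    = refl
classify-vertex (true  ∷ R) (inj₁ (Fin.suc a)) = cong (Sum.map₁ Fin.suc) (classify-vertex R (inj₁ a))
classify-vertex (true  ∷ R) (inj₂ i)           = cong (Sum.map₁ Fin.suc) (classify-vertex R (inj₂ i))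
classify-vertex (false ∷ R) (inj₁ a)           = cong (Sum.map₂ Fin.suc) (classify-vertex R (inj₁ a))
classify-vertex (false ∷ R) (inj₂ Fin.zero)    = refl
classify-vertex (false ∷ R) (inj₂ (Fin.suc i)) = cong (Sum.map₂ Fin.suc) (classify-vertex R (inj₂ i))

vertex-classify : ∀ {N} (R : Subset N) v → vertex R (classify R v) ≡ v
vertex-classify (true  ∷ R) Fin.zero    = refl
vertex-classify (true  ∷ R) (Fin.suc v) with classify R v | vertex-classify R v
... | inj₁ a | eq = cong Fin.suc eq
... | inj₂ i | eq = cong Fin.suc eq
vertex-classify (false ∷ R) Fin.zero    = refl
vertex-classify (false ∷ R) (Fin.suc v) with classify R v | vertex-classify R v
... | inj₁ a | eq = cong Fin.suc eq
... | inj₂ i | eq = cong Fin.suc eq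

vertex-root : ∀ {N} (R : Subset N) a → vertex R (inj₁ a) ∈ R
vertex-root (true  ∷ R) Fin.zero    = here
vertex-root (true  ∷ R) (Fin.suc a) = there (vertex-root R a)
vertex-root (false ∷ R) a           = there (vertex-root R a)

vertex-nonroot : ∀ {N} (R : Subset N) i → vertex R (inj₂ i) ∉ R
vertex-nonroot (true  ∷ R) i           (there i∈) = vertex-nonroot R i i∈
vertex-nonroot (false ∷ R) (Fin.suc i) (there i∈) = vertex-nonroot R i i∈

-- The bijection between codes and forests

describes-map : ∀ {N} {Par Par′ : Fin N → Fin N → Set} {A} →
  (∀ {u v} → Par u v → Par′ u v) → (∀ {u v} → Par′ u v → Par u v) →
  Describes Par A → Describes Par′ A
describes-map to from d u v = Sum.map to to ∘ proj₁ (d u v) , proj₂ (d u v) ∘ Sum.map from from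

module Bijection {n : ℕ} (R : Subset (suc n)) (m≤n : ∣ ∁ R ∣ ≤ n)
                 (k≡ : suc (n ∸ ∣ ∁ R ∣) ≡ ∣ R ∣) (k+m≡ : ∣ R ∣ + ∣ ∁ R ∣ ≡ suc n) where

  -- With `m` defined as the number of non-roots, no transport along `∣ ∁ R ∣ ≡ m` is needed; the
  -- theorem reaches this form by matching on that equation.
  m : ℕ
  m = ∣ ∁ R ∣

  open Codes {∣ R ∣} {m} {n} k≡ k+m≡

  Par : Vec ℕ n → Vec (Fin m) m → Fin (suc n) → Fin (suc n) → Set
  Par r σ v u = ParW r σ (classify R v) (classify R u)

  par? : ∀ r σ → Decidable (Par r σ)
  par? r σ v u = parW? r σ (classify R v) (classify R u)

  abstract
    graph : Vec ℕ n → Vec (Fin m) m → Vec (Vec Bool (suc n)) (suc n)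
    graph r σ = graphOf (par? r σ)

    graph-describes : ∀ r σ → Describes (Par r σ) (graph r σ)
    graph-describes r σ = graphOf-describes (par? r σ)

  decode : ∀ {r σ} → Valid r σ → ParentStructure R (position σ ∘ classify R) (Par r σ)
  decode {r} {σ} valid = record
    { orphan   = orphan
    ; parent   = parent
    ; unique   = λ p q → classify-injective (par-unique p q)
    ; descends = par-descends }
    where
    open Code valid

    orphan : ∀ {ρ u} → ρ ∈ R → ¬ Par r σ ρ u
    orphan {ρ} ρ∈ p with classify R ρ | vertex-classify R ρ
    orphan {ρ} ρ∈ (block _) | inj₂ i | eq = vertex-nonroot R i (subst (_∈ R) (sym eq) ρ∈)

    parent : ∀ {v} → v ∉ R → ∃ (Par r σ v)
    parent {v} v∉ with classify R v | vertex-classify R v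
    ... | inj₁ a | eq = contradiction (subst (_∈ R) eq (vertex-root R a)) v∉
    ... | inj₂ i | eq with par-exists i
    ...   | w , p = vertex R w , subst (ParW r σ (inj₂ i)) (sym (classify-vertex R w)) p

    classify-injective : ∀ {u v} → classify R u ≡ classify R v → u ≡ v
    classify-injective {u} {v} eq =
      trans (sym (vertex-classify R u)) (trans (cong (vertex R) eq) (vertex-classify R v))

  encode : ∀ {A} → IsRootedForest R A → ∃₂ λ r σ → Valid r σ × graph r σ ≡ A
  encode {A} forest with parentsOf forest
  ... | up , depth , up-descends , up-describes
    with encodeParents (classify R ∘ up ∘ vertex R ∘ inj₂) (depth ∘ vertex R)
           (λ i → subst (λ v → depth v < depth (vertex R (inj₂ i)))
             (sym (vertex-classify R _)) (up-descends (vertex-nonroot R i)))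
  ... | r , σ , valid , par = r , σ , valid ,
    describes-unique (graph-describes r σ) (describes-map {A = A} to from up-describes)
    where
    to : ∀ {v u} → v ∉ R × up v ≡ u → Par r σ v u
    to {v} (v∉ , refl) with classify R v | vertex-classify R v
    ... | inj₁ a | eq   = contradiction (subst (_∈ R) eq (vertex-root R a)) v∉
    ... | inj₂ i | refl = par i

    from : ∀ {v u} → Par r σ v u → v ∉ R × up v ≡ u
    -- A vertex has at most one parent in the code, and `to` has already identified it as `up v`.
    from {v} p = v∉ , ParentStructure.unique (decode valid) (to (v∉ , refl)) p
      where
      v∉ : v ∉ R
      v∉ v∈ = ParentStructure.orphan (decode valid) v∈ p

  Realized : Vec (Vec Bool (suc n)) (suc n) → Set
  Realized A = ∃ λ (r̂ : Vec (Fin (suc m)) n) → ∃ λ σ →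
    Valid (map toℕ r̂) σ × graph (map toℕ r̂) σ ≡ A

  realized? : ∀ A → Dec (Realized A)
  realized? A = anyVec? λ r̂ → anyVec? λ σ →
    valid? (map toℕ r̂) σ ×-dec ≡-dec (≡-dec Bool._≟_) (graph (map toℕ r̂) σ) A

  realized : ∀ {A} → IsRootedForest R A → Realized A
  realized forest with encode forest
  ... | r , σ , valid , eq with bounded-entries r (≤-reflexive (proj₁ (Valid.ballot valid)))
  ...   | r̂ , refl = r̂ , σ , valid , eq

  𝒞-valid : ∀ {r : Vec ℕ n} {σ : Vec (Fin m) m} →
    IsPerm σ → Compatible r σ → Balanced m r → Valid r σ
  𝒞-valid {r} {σ} perm compat bal = record
    { perm = perm ; ordered = compatible⇒ordered r σ compat ; ballot = balanced⇒ballot bal }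

  toForest : 𝒞 m n → ℱ (suc n) R
  toForest (mk𝒞 r σ perm compat bal) = mkℱ (graph r σ)
    (FromParents.isRootedForest (decode (𝒞-valid perm compat bal)) (graph-describes r σ))

  graph-injective : ∀ {r r′ σ σ′} → Valid r σ → Valid r′ σ′ → graph r σ ≡ graph r′ σ′ →
    r ≡ r′ × σ ≡ σ′
  graph-injective {r} {r′} {σ} {σ′} valid valid′ eq =
    code-unique valid valid′ (transfer eq) (transfer (sym eq))
    where
    transfer : ∀ {r r′ σ σ′} → graph r σ ≡ graph r′ σ′ →
      ∀ {u v} → Edge (ParW r σ) u v → Edge (ParW r′ σ′) u v
    transfer {r} {r′} {σ} {σ′} eq {u} {v} e =
      subst₂ (Edge (ParW r′ σ′)) (classify-vertex R u) (classify-vertex R v)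
        (proj₁ (graph-describes r′ σ′ _ _)
          (subst (λ A → Adj A (vertex R u) (vertex R v)) eq
            (proj₂ (graph-describes r σ _ _)
              (subst₂ (Edge (ParW r σ)) (sym (classify-vertex R u)) (sym (classify-vertex R v)) e))))

  toForest-injective : Injective _≡_ _≡_ toForest
  toForest-injective {mk𝒞 r σ perm compat bal} {mk𝒞 r′ σ′ perm′ compat′ bal′} eq
    -- The validity proofs are irrelevant, but equality of vectors is decidable, so the equation
    -- they yield can be made relevant again.
    with recompute (≡-dec _≟_ r r′ ×-dec ≡-dec Fin._≟_ σ σ′)
           (graph-injective (𝒞-valid perm compat bal) (𝒞-valid perm′ compat′ bal′) (cong ℱ.adj eq))
  ... | refl , refl = refl

  toForest-surjective : Surjective _≡_ _≡_ toForest
  toForest-surjective (mkℱ A forest) with recompute (realized? A) (realized forest)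
  ... | r̂ , σ , valid , refl =
    mk𝒞 (map toℕ r̂) σ (Valid.perm valid)
      (ordered⇒compatible (map toℕ r̂) σ (proj₁ (Valid.ballot valid)) (Valid.ordered valid))
      (ballot⇒balanced m≤n (Valid.ballot valid)) ,
    λ { refl → refl }

theorem2p4 : (m n : ℕ) → 1 ≤ m → m ≤ n →
    (R : Subset (suc n)) → ∣ R ∣ ≡ suc n ∸ m →
    𝒞 m n ⤖ ℱ (suc n) R
theorem2p4 m n _ m≤n R ∣R∣≡ with
  trans (∣∁p∣≡n∸∣p∣ R) (trans (cong (suc n ∸_) ∣R∣≡) (m∸[m∸n]≡n (m≤n⇒m≤1+n m≤n)))
... | refl = mk⤖ (toForest-injective , toForest-surjective)
  where
  open Bijection R m≤n (trans (sym (+-∸-assoc 1 m≤n)) (sym ∣R∣≡))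
    (trans (cong (_+ ∣ ∁ R ∣) ∣R∣≡) (m∸n+n≡m (m≤n⇒m≤1+n m≤n)))
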